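{- Let $p_1,p_2,\dots,p_r$ be distinct primes, let $k$ and $m$ be positive integers, and let $N\in\eta[p_i]$ with $\gcd(N,k)=1$. Then $$O_N\big(k+\Lambda_{\eta[p_i]}(k)\,m\big)=O_N(k).$$
   Context: $O_N(k)$ is the multiplicative order of $k$ modulo $N$. $\eta[p_i]=\{p_1^{a_1}p_2^{a_2}\cdots p_r^{a_r} : a_i\in\mathbb{Z}_{\ge 0}\}$. $\nu_p(x)$ is the exponent of the prime $p$ in $x$. For a prime $p\nmid k$ and $k>1$, $\gamma_p(k)=\nu_p(k^u-1)$ with $u=O_p(k)$, unless $p=2$ and $k-1$ is twice an odd integer, in which case $\gamma_2(k)=\nu_2(k^2-1)$; if $p$ divides no $k^u-1$ then $\gamma_p(k)=0$. For $k>1$, $\Lambda_{\eta[p_i]}(k)=\prod_{i=1}^r p_i^{\gamma_{p_i}(k)+1}$, and $\Lambda_{\eta[p_i]}(1)=0$. -}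

module Defs where

open import Data.Fin.Base using (Fin; toℕ; fromℕ<)
open import Data.Fin.Properties using (pigeonhole; toℕ-fromℕ<; toℕ<n)
open import Data.Nat.Base
open import Data.Nat.Coprimality using (Coprime; coprime-divisor)
open import Data.Nat.Divisibility
open import Data.Nat.DivMod using (m≡m%n+[m/n]*n; m%n<n)
open import Data.Nat.Properties
open import Data.Product using (∃; _×_; _,_; proj₁; proj₂; map₂)
open import Data.Sum using (_⊎_; inj₁; inj₂)
open import Level using (0ℓ)
open import Relation.Binary.PropositionalEquality
open import Relation.Nullary using (¬_; Dec; yes; no; contradiction)
open import Relation.Nullary.Decidable using (_×-dec_; ¬?; map′)
open import Relation.Unary using (Pred; Decidable)

import Algebra.Properties.CommutativeMonoid.Sum *-1-commutativeMonoid as Product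

∏ : ∀ {r} → (Fin r → ℕ) → ℕ
∏ = Product.sum

Least : Pred ℕ 0ℓ → Pred ℕ 0ℓ
Least P n = P n × (∀ m → P m → n ≤ m)

least<? : ∀ {P : Pred ℕ 0ℓ} → Decidable P → ∀ b →
          ∃ (Least P) ⊎ (∀ m → m < b → ¬ P m)
least<? P? zero = inj₂ λ _ ()
least<? P? (suc b) with least<? P? b
... | inj₁ l = inj₁ l
... | inj₂ none with P? b
...   | yes Pb = inj₁ (b , Pb , λ m Pm → ≮⇒≥ λ m<b → none m m<b Pm)
...   | no ¬Pb = inj₂ λ m m<1+b Pm → case (m≤n⇒m<n∨m≡n (s≤s⁻¹ m<1+b)) Pm
  where
  case : ∀ {m} → m < b ⊎ m ≡ b → ¬ _
  case (inj₁ m<b) = none _ m<b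
  case (inj₂ refl) = ¬Pb

-- k ^ u ≡ 1 (mod N) with u positive.  The absolute difference ∣_-_∣ is used
-- rather than ∸ so that k = 0 is not counted as satisfying this.
UnitExponent : ℕ → ℕ → Pred ℕ 0ℓ
UnitExponent N k u = 0 < u × N ∣ ∣ k ^ u - 1 ∣

IsOrder : ℕ → ℕ → Pred ℕ 0ℓ
IsOrder N k = Least (UnitExponent N k)

private
  %≡%⇒∣ : ∀ m n N .{{_ : NonZero N}} → m % N ≡ n % N → N ∣ ∣ m - n ∣
  %≡%⇒∣ m n N eq = divides ∣ m / N - n / N ∣ (begin
    ∣ m - n ∣
      ≡⟨ cong₂ ∣_-_∣ (m≡m%n+[m/n]*n m N) (m≡m%n+[m/n]*n n N) ⟩
    ∣ m % N + m / N * N - n % N + n / N * N ∣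
      ≡⟨ cong (λ r → ∣ r + m / N * N - n % N + n / N * N ∣) eq ⟩
    ∣ n % N + m / N * N - n % N + n / N * N ∣
      ≡⟨ ∣m+n-m+o∣≡∣n-o∣ (n % N) _ _ ⟩
    ∣ m / N * N - n / N * N ∣
      ≡⟨ *-distribʳ-∣-∣ N (m / N) (n / N) ⟨
    ∣ m / N - n / N ∣ * N ∎)
    where open ≡-Reasoning

  cancel-^ : ∀ {N k x} → Coprime N k → ∀ i → N ∣ k ^ i * x → N ∣ x
  cancel-^ {N} {k} {x} c zero    d = subst (N ∣_) (*-identityˡ x) d
  cancel-^ {N} {k} {x} c (suc i) d =
    cancel-^ c i (coprime-divisor c (subst (N ∣_) (*-assoc k (k ^ i) x) d))

  ∣n∣n-1⇒∣1 : ∀ {d} n → d ∣ n → d ∣ ∣ n - 1 ∣ → d ∣ 1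
  ∣n∣n-1⇒∣1     zero    _   d∣1 = d∣1
  ∣n∣n-1⇒∣1 {d} (suc n) d∣n d∣n-1 =
    ∣m+n∣m⇒∣n (subst (d ∣_) (+-comm 1 n) d∣n)
              (subst (d ∣_) (∣-∣-identityʳ n) d∣n-1)

unitExponent⇒coprime : ∀ {N k u} → UnitExponent N k u → Coprime N k
unitExponent⇒coprime {k = k} {suc u} (_ , N∣) (d∣N , d∣k) =
  ∣1⇒≡1 (∣n∣n-1⇒∣1 (k ^ suc u) (∣m⇒∣m*n (k ^ u) d∣k) (∣-trans d∣N N∣))

coprime⇒unitExponent : ∀ {N k} .{{_ : NonZero N}} → Coprime N k →
                       ∃ λ u → u ≤ N × UnitExponent N k u
coprime⇒unitExponent {N} {k} c
  with i , j , i<j , eq ← pigeonhole (n<1+n N) (λ i → fromℕ< (m%n<n (k ^ toℕ i) N))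
  = b ∸ a , ≤-trans (m∸n≤m b a) (s≤s⁻¹ (toℕ<n j)) , m<n⇒0<n∸m i<j
  , cancel-^ c a (subst (N ∣_) factor (%≡%⇒∣ (k ^ b) (k ^ a) N (sym eq′)))
  where
  a = toℕ i
  b = toℕ j
  eq′ : k ^ a % N ≡ k ^ b % N
  eq′ = trans (sym (toℕ-fromℕ< _)) (trans (cong toℕ eq) (toℕ-fromℕ< _))
  open ≡-Reasoning
  factor : ∣ k ^ b - k ^ a ∣ ≡ k ^ a * ∣ k ^ (b ∸ a) - 1 ∣
  factor = begin
    ∣ k ^ b - k ^ a ∣
      ≡⟨ cong (λ e → ∣ k ^ e - k ^ a ∣) (m+[n∸m]≡n (<⇒≤ i<j)) ⟨
    ∣ k ^ (a + (b ∸ a)) - k ^ a ∣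
      ≡⟨ cong₂ ∣_-_∣ (^-distribˡ-+-* k a (b ∸ a)) (sym (*-identityʳ (k ^ a))) ⟩
    ∣ k ^ a * k ^ (b ∸ a) - k ^ a * 1 ∣
      ≡⟨ *-distribˡ-∣-∣ (k ^ a) _ _ ⟨
    k ^ a * ∣ k ^ (b ∸ a) - 1 ∣ ∎

unitExponent-bounded : ∀ {N k u} → UnitExponent N k u →
                       ∃ λ v → v ≤ suc N × UnitExponent N k v
unitExponent-bounded {suc N} e
  with v , v≤N , e′ ← coprime⇒unitExponent (unitExponent⇒coprime e)
  = v , m≤n⇒m≤1+n v≤N , e′
unitExponent-bounded {zero} {k} {suc u} (_ , 0∣)
  with m^n≡1⇒n≡0∨m≡1 k (suc u) (∣m-n∣≡0⇒m≡n (0∣⇒≡0 0∣))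
... | inj₂ refl = 1 , ≤-refl , z<s , ∣-refl

order? : ∀ N k → Dec (∃ (IsOrder N k))
order? N k with least<? (λ u → 0 <? u ×-dec N ∣? ∣ k ^ u - 1 ∣) (2 + N)
... | inj₁ l    = yes l
... | inj₂ none = no λ (u , e , _) →
  let v , v≤ , e′ = unitExponent-bounded e in none v (s≤s v≤) e′

-- The value is 0 if no positive power of k is congruent to 1 modulo N.
O : ℕ → ℕ → ℕ
O N k with order? N k
... | yes (u , _) = u
... | no _        = 0

coprime⇒isOrder : ∀ {N k} .{{_ : NonZero N}} → Coprime N k → IsOrder N k (O N k)
coprime⇒isOrder {N} {k} c with order? N k
... | yes (_ , isOrder) = isOrder
... | no none with u , _ , e ← coprime⇒unitExponent c
              with least<? (λ u → 0 <? u ×-dec N ∣? ∣ k ^ u - 1 ∣) (suc u)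
...   | inj₁ l   = contradiction l none
...   | inj₂ ¬e  = contradiction e (¬e u (n<1+n u))

IsExponent : ℕ → ℕ → Pred ℕ 0ℓ
IsExponent p x e = p ^ e ∣ x × ¬ p ^ suc e ∣ x

private
  n<m^n : ∀ m .{{_ : NonTrivial m}} n → n < m ^ n
  n<m^n m zero    = z<s
  n<m^n m (suc n) = ≤-<-trans (n<m^n m n)
    (m<m*n′ (m ^ n) {{m^n≢0 m n {{nonTrivial⇒nonZero m}}}})
    where
    m<m*n′ : ∀ x .{{_ : NonZero x}} → x < m * x
    m<m*n′ x = subst (x <_) (*-comm x m) (m<m*n x m (nonTrivial⇒n>1 m))

isExponent⇒≤ : ∀ {p x e} → IsExponent p x e → e ≤ x
isExponent⇒≤ {x = zero}                   (_ , ∤)   = contradiction (_ ∣0) ∤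
isExponent⇒≤ {x = suc x} {zero}           _         = z≤n
isExponent⇒≤ {zero} {suc x} {suc e}       (0∣ , _)  with () ← 0∣⇒≡0 0∣
isExponent⇒≤ {1} {suc x} {suc e}          (_ , ∤)   =
  contradiction (subst (_∣ suc x) (sym (^-zeroˡ (suc (suc e)))) (1∣ suc x)) ∤
isExponent⇒≤ {p@(2+ _)} {suc x} {e@(suc _)} (d , _) =
  ≤-trans (<⇒≤ (n<m^n p e)) (∣⇒≤ d)

exponent? : ∀ p x → Dec (∃ (IsExponent p x))
exponent? p x = map′ (map₂ proj₂) (λ (e , h) → e , s≤s (isExponent⇒≤ {p} h) , h)
  (anyUpTo? (λ e → p ^ e ∣? x ×-dec ¬? (p ^ suc e ∣? x)) (suc x))

-- The value is 0 if there is no largest power of p dividing x (x = 0 or p = 1).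
ν : ℕ → ℕ → ℕ
ν p x with exponent? p x
... | yes (e , _) = e
... | no _        = 0

TwiceOdd : Pred ℕ 0ℓ
TwiceOdd n = ∃ λ j → n ≡ 2 * (2 * j + 1)

twiceOdd? : Decidable TwiceOdd
twiceOdd? n = map′ (map₂ proj₂) (λ (j , eq) → j , j<1+n j eq , eq)
  (anyUpTo? (λ j → n ≟ 2 * (2 * j + 1)) (suc n))
  where
  open ≤-Reasoning
  j<1+n : ∀ j → n ≡ 2 * (2 * j + 1) → j < suc n
  j<1+n j eq = s≤s (begin
    j                ≤⟨ m≤n*m j 2 ⟩
    2 * j            ≤⟨ m≤m+n (2 * j) 1 ⟩
    2 * j + 1        ≤⟨ m≤n*m (2 * j + 1) 2 ⟩
    2 * (2 * j + 1)  ≡⟨ eq ⟨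
    n                ∎)

-- Only meant for p prime and k > 1.  When it exists, u is the order of k modulo p;
-- it fails to exist exactly when p divides no k ^ u - 1 with u positive.
γ : ℕ → ℕ → ℕ
γ p k with p ≟ 2 ×-dec twiceOdd? (k ∸ 1) | order? p k
... | yes _ | _           = ν 2 ∣ k ^ 2 - 1 ∣
... | no _  | yes (u , _) = ν p ∣ k ^ u - 1 ∣
... | no _  | no _        = 0

η : ∀ {r} → (Fin r → ℕ) → Pred ℕ 0ℓ
η {r} p N = ∃ λ (a : Fin r → ℕ) → N ≡ ∏ (λ i → p i ^ a i)

Λ : ∀ {r} → (Fin r → ℕ) → ℕ → ℕ
Λ p k with k ≟ 1
... | yes _ = 0
... | no _  = ∏ (λ i → p i ^ (γ (p i) k + 1))

{-# OPTIONS --safe #-}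
module Submission where

-- O N k depends only on the set of n with N ∣ k ^ n - 1, so it suffices to treat each
-- prime power p ^ a dividing N, with p ∤ k.  Let v be the order of k modulo p (v = 2 if p = 2 and
-- k ≡ 3 mod 4) and g = γ p k = ν p (k ^ v - 1).  Lifting the exponent gives
-- p ^ a ∣ k ^ (v q) - 1  ⇔  p ^ a ∣ p ^ g * q, and the same v and g serve for any number
-- congruent to k modulo p ^ (g + 1).  If v ∤ n then p ^ (g + 1) ∤ k ^ n - 1, and
-- divisibility by smaller powers of p is preserved by the congruence itself.

open import Defs
open import Data.Fin.Base using (Fin; zero; suc)
open import Data.Fin.Properties using (suc-injective)
open import Data.Nat.Base
open import Data.Nat.Divisibility
open import Data.Nat.DivMod using (m≡m%n+[m/n]*n; m%n<n)
open import Data.Nat.GCD using (gcd)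
open import Data.Nat.Induction using (<-rec)
open import Data.Nat.Primality
open import Data.Nat.Properties hiding (suc-injective)
open import Data.Nat.Tactic.RingSolver using (solve-∀)
open import Data.Product using (∃; _×_; _,_; proj₁; proj₂)
open import Data.Sum using (_⊎_; inj₁; inj₂; [_,_]′)
open import Function.Base using (_∘_; case_of_)
open import Function.Bundles using (_⇔_; mk⇔; Equivalence)
open import Function.Definitions using (Injective)
open import Relation.Binary.PropositionalEquality
open import Relation.Nullary using (¬_; yes; no; contradiction; _×-dec_)
open import Relation.Unary using (_∈_)
import Function.Properties.Equivalence as ⇔

open Equivalence using (to; from)

-- Divisibility by primes and prime powers

∣-congʳ-⇔ : ∀ {d m n} → m ≡ n → d ∣ m ⇔ d ∣ n
∣-congʳ-⇔ refl = ⇔.refl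

∣-+-⇔ : ∀ {d m n} → d ∣ n → d ∣ m + n ⇔ d ∣ m
∣-+-⇔ {d} {m} {n} d∣n =
  mk⇔ (λ d∣ → ∣m+n∣m⇒∣n (subst (d ∣_) (+-comm m n) d∣) d∣n) (λ d∣m → ∣m∣n⇒∣m+n d∣m d∣n)

*-∣-⇔ : ∀ d .{{_ : NonZero d}} {m n} → d * m ∣ d * n ⇔ m ∣ n
*-∣-⇔ d = mk⇔ (*-cancelˡ-∣ d) (*-monoʳ-∣ d)

^-monoʳ-∣ : ∀ p {a b} → a ≤ b → p ^ a ∣ p ^ b
^-monoʳ-∣ p {a} a≤b with o , refl ← m≤n⇒∃[o]m+o≡n a≤b
  rewrite ^-distribˡ-+-* p a o = m∣m*n (p ^ o)

1∤prime : ∀ {p} → Prime p → ¬ p ∣ 1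
1∤prime pp p∣1 with refl ← ∣1⇒≡1 p∣1 = ¬prime[1] pp

prime∣prime⇒≡ : ∀ {p q} → Prime p → Prime q → p ∣ q → p ≡ q
prime∣prime⇒≡ pp pq p∣q with prime⇒irreducible pq p∣q
... | inj₁ refl = contradiction pp ¬prime[1]
... | inj₂ p≡q  = p≡q

prime∣^⇒∣ : ∀ {p} → Prime p → ∀ n e → p ∣ n ^ e → p ∣ n
prime∣^⇒∣ pp n zero    p∣1 = contradiction p∣1 (1∤prime pp)
prime∣^⇒∣ pp n (suc e) p∣  = [ (λ d → d) , prime∣^⇒∣ pp n e ]′ (euclidsLemma n (n ^ e) pp p∣)

-- Each of the `b` factors of `p` must fall into `x` by Euclid's lemma; one is cancelled per
-- induction step.
prime^-cancel : ∀ {p c} → Prime p → ¬ p ∣ c → ∀ b {x} → p ^ b ∣ c * x → p ^ b ∣ x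
prime^-cancel pp p∤c zero    {x} _ = 1∣ x
prime^-cancel {p} {c} pp p∤c (suc b) {x} d
  with euclidsLemma c x pp (∣-trans (m∣m*n (p ^ b)) d)
... | inj₁ p∣c = contradiction p∣c p∤c
... | inj₂ (divides-refl q) = subst (p * p ^ b ∣_) (*-comm p q) (*-monoʳ-∣ p
  (prime^-cancel pp p∤c b (*-cancelˡ-∣ p (subst (p * p ^ b ∣_) (identity c q p) d))))
  where
  instance _ = prime⇒nonZero pp
  identity : ∀ c q p → c * (q * p) ≡ p * (c * q)
  identity = solve-∀

prime^-∣-*-⇔ : ∀ {p c} → Prime p → ¬ p ∣ c → ∀ b {x} → p ^ b ∣ c * x ⇔ p ^ b ∣ x
prime^-∣-*-⇔ {c = c} pp p∤c b = mk⇔ (prime^-cancel pp p∤c b) (∣n⇒∣m*n c)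

parity-split : ∀ n → ∃ λ j → n ≡ 2 * j ⊎ n ≡ 1 + 2 * j
parity-split zero = 0 , inj₁ refl
parity-split (suc n) with parity-split n
... | j , inj₁ refl = j , inj₂ refl
... | j , inj₂ refl = suc j , inj₁ (identity j)
  where
  identity : ∀ j → 1 + (1 + 2 * j) ≡ 2 * (1 + j)
  identity = solve-∀

-- Lifting the exponent

-- The geometric sum 1 + x + ... + x^(n-1) for x = 1 + y, that is (x^n - 1)/(x - 1). Taking `y`
-- rather than x as the parameter avoids subtraction.
geo : ℕ → ℕ → ℕ
geo y zero    = 0
geo y (suc n) = 1 + (1 + y) * geo y n

[1+y]^n≡1+y*geo : ∀ y n → (1 + y) ^ n ≡ 1 + y * geo y n
[1+y]^n≡1+y*geo y zero    = sym (cong suc (*-zeroʳ y))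
[1+y]^n≡1+y*geo y (suc n) =
  trans (cong ((1 + y) *_) ([1+y]^n≡1+y*geo y n)) (identity y (geo y n))
  where
  identity : ∀ y s → (1 + y) * (1 + y * s) ≡ 1 + y * (1 + (1 + y) * s)
  identity = solve-∀

geo-+ : ∀ y m n → geo y (m + n) ≡ geo y m + (1 + y) ^ m * geo y n
geo-+ y zero    n = sym (*-identityˡ (geo y n))
geo-+ y (suc m) n = trans (cong (λ s → 1 + (1 + y) * s) (geo-+ y m n))
  (identity y (geo y m) ((1 + y) ^ m) (geo y n))
  where
  identity : ∀ y s x t → 1 + (1 + y) * (s + x * t) ≡ 1 + (1 + y) * s + (1 + y) * x * t
  identity = solve-∀

-- With x = 1 + y this splits (x^(mn) - 1)/(x - 1) through x^n - 1, which is `y * geo y n`; the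
-- second factor is the geometric sum with ratio x^n.
geo-* : ∀ y m n → geo y (m * n) ≡ geo y n * geo (y * geo y n) m
geo-* y zero    n = sym (*-zeroʳ (geo y n))
geo-* y (suc m) n = begin
  geo y (n + m * n)
    ≡⟨ geo-+ y n (m * n) ⟩
  geo y n + (1 + y) ^ n * geo y (m * n)
    ≡⟨ cong₂ (λ a b → geo y n + a * b) ([1+y]^n≡1+y*geo y n) (geo-* y m n) ⟩
  geo y n + (1 + y * geo y n) * (geo y n * geo (y * geo y n) m)
    ≡⟨ identity (y * geo y n) (geo y n) (geo (y * geo y n) m) ⟩
  geo y n * (1 + (1 + y * geo y n) * geo (y * geo y n) m) ∎
  where
  open ≡-Reasoning
  identity : ∀ z s t → s + (1 + z) * (s * t) ≡ s * (1 + (1 + z) * t)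
  identity = solve-∀

-- The binomial coefficient "n choose 2", defined without division.
tri : ℕ → ℕ
tri zero    = 0
tri (suc n) = tri n + n

2*tri : ∀ n → 2 * tri n + n ≡ n * n
2*tri zero    = refl
2*tri (suc n) = trans (identity₁ (tri n) n) (trans (cong (_+ (n + suc n)) (2*tri n)) (identity₂ n))
  where
  identity₁ : ∀ t n → 2 * (t + n) + (1 + n) ≡ 2 * t + n + (n + (1 + n))
  identity₁ = solve-∀
  identity₂ : ∀ n → n * n + (n + (1 + n)) ≡ (1 + n) * (1 + n)
  identity₂ = solve-∀

-- The start of the binomial expansion of ((1 + y)^n - 1)/y.
geo-mod-y² : ∀ y n → ∃ λ c → geo y n ≡ n + y * (tri n + y * c)
geo-mod-y² y zero    = 0 , sym (trans (cong (y *_) (*-zeroʳ y)) (*-zeroʳ y))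
geo-mod-y² y (suc n) with c , eq ← geo-mod-y² y n =
  tri n + c + y * c , trans (cong (λ s → 1 + (1 + y) * s) eq) (identity y n (tri n) c)
  where
  identity : ∀ y n t c →
    1 + (1 + y) * (n + y * (t + y * c)) ≡ 1 + n + y * (t + n + y * (t + c + y * c))
  identity = solve-∀

-- Beyond p ∣ y this only asks, for p = 2, that 4 ∣ y; it is the condition under
-- which 1 + x + ⋯ + x^(p-1) ≡ p (mod p²) for x = 1 + y.
Regular : ℕ → ℕ → Set
Regular p y = ∃ λ t → y ≡ p * t × p ∣ t * tri p

-- Since 2 * `tri p` = p² - p, an odd prime `p` divides `tri p` itself.
regular-odd : ∀ {p y} → Prime p → p ≢ 2 → p ∣ y → Regular p y
regular-odd {p} pp p≢2 (divides t eq) = t , trans eq (*-comm t p) , ∣n⇒∣m*n t p∣tri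
  where
  p∣2*tri : p ∣ 2 * tri p
  p∣2*tri = to (∣-+-⇔ ∣-refl) (subst (p ∣_) (sym (2*tri p)) (m∣m*n p))
  p∣tri : p ∣ tri p
  p∣tri with euclidsLemma 2 (tri p) pp p∣2*tri
  ... | inj₁ p∣2 = contradiction (prime∣prime⇒≡ pp prime[2] p∣2) p≢2
  ... | inj₂ p∣t = p∣t

regular-2 : ∀ j → Regular 2 (4 * j)
regular-2 j = 2 * j , identity j , ∣m⇒∣m*n 1 (m∣m*n j)
  where
  identity : ∀ j → 4 * j ≡ 2 * (2 * j)
  identity = solve-∀

-- In the expansion p + y * `tri p` + y² c, regularity makes both later terms multiples of p². Hence
-- `geo y p` contains `p` exactly once.
geo-regular : ∀ {p y} → Regular p y → ∃ λ w → geo y p ≡ p * (1 + p * w)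
geo-regular {p} (t , refl , divides s eq) with c , geo≡ ← geo-mod-y² (p * t) p =
  s + t * t * c , trans geo≡ (trans (identity₁ p t (tri p) c)
    (trans (cong (λ z → p + p * z + p * p * (t * t * c)) eq) (identity₂ p s (t * t * c))))
  where
  identity₁ : ∀ p t T c → p + p * t * (T + p * t * c) ≡ p + p * (t * T) + p * p * (t * t * c)
  identity₁ = solve-∀
  identity₂ : ∀ p s d → p + p * (s * p) + p * p * d ≡ p * (1 + p * (s + d))
  identity₂ = solve-∀

-- Lets the induction for `prime^∣geo⇔` pass from the ratio x = 1 + y to x^p.
regular-*-geo : ∀ {p y} → Regular p y → Regular p (y * geo y p)
regular-*-geo {p} {y} reg@(t , refl , p∣) with w , eq ← geo-regular reg =
  t * geo y p , *-assoc p t (geo y p) ,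
  ∣m⇒∣m*n (tri p) (∣n⇒∣m*n t (subst (p ∣_) (sym eq) (m∣m*n (1 + p * w))))

-- The valuations of `geo y n` and `n` agree; quantifying over `b` covers n = 0 too. As p ∣ y,
-- `geo y n` ≡ n modulo `p`. If n = m p, `geo-*` splits off `geo y p`, which contributes a single
-- `p`, and induction on `b` treats the cofactor with ratio x^p.
prime^∣geo⇔ : ∀ {p y} → Prime p → Regular p y → ∀ b n → p ^ b ∣ geo y n ⇔ p ^ b ∣ n
prime^∣geo⇔ {p} {y} pp reg zero    n = mk⇔ (λ _ → 1∣ n) (λ _ → 1∣ geo y n)
prime^∣geo⇔ {p} {y} pp reg@(t , refl , _) (suc b) n = mk⇔
  (λ d → divisible (∣geo⇒∣ (∣-trans (m∣m*n (p ^ b)) d)) .to d)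
  (λ d → divisible (∣-trans (m∣m*n (p ^ b)) d) .from d)
  where
  instance _ = prime⇒nonZero pp
  ∣geo⇒∣ : p ∣ geo y n → p ∣ n
  ∣geo⇒∣ p∣ with c , eq ← geo-mod-y² y n =
    to (∣-+-⇔ (∣m⇒∣m*n (tri n + y * c) (m∣m*n t))) (subst (p ∣_) eq p∣)
  divisible : p ∣ n → p ^ suc b ∣ geo y n ⇔ p ^ suc b ∣ n
  divisible (divides-refl m) with w , eq ← geo-regular reg =
    ⇔.trans (∣-congʳ-⇔ (trans (geo-* y m p) (trans (cong (_* geo (y * geo y p) m) eq) (*-assoc p _ _))))
    (⇔.trans (*-∣-⇔ p)
    (⇔.trans (prime^-∣-*-⇔ pp p∤ b)
    (⇔.trans (prime^∣geo⇔ pp (regular-*-geo reg) b m)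
    (⇔.trans (⇔.sym (*-∣-⇔ p)) (∣-congʳ-⇔ (*-comm p m))))))
    where
    p∤ : ¬ p ∣ 1 + p * w
    p∤ = 1∤prime pp ∘ to (∣-+-⇔ (m∣m*n w))

-- For a ≤ g both sides hold outright; otherwise `p ^ g` cancels.
*-^-∣-cong : ∀ p .{{_ : NonZero p}} {x y} → (∀ b → p ^ b ∣ x ⇔ p ^ b ∣ y) →
             ∀ a g → p ^ a ∣ p ^ g * x ⇔ p ^ a ∣ p ^ g * y
*-^-∣-cong p {x} {y} x⇔y a g with ≤-total a g
... | inj₁ a≤g = mk⇔ (λ _ → ∣m⇒∣m*n y (^-monoʳ-∣ p a≤g)) (λ _ → ∣m⇒∣m*n x (^-monoʳ-∣ p a≤g))
... | inj₂ g≤a with b , refl ← m≤n⇒∃[o]m+o≡n g≤a rewrite ^-distribˡ-+-* p g b =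
  ⇔.trans (*-∣-⇔ (p ^ g)) (⇔.trans (x⇔y b) (⇔.sym (*-∣-⇔ (p ^ g))))
  where instance _ = m^n≢0 p g

prime^∣y*geo⇔ : ∀ {p y g} → Prime p → Regular p y → IsExponent p y g →
                ∀ a n → p ^ a ∣ y * geo y n ⇔ p ^ a ∣ p ^ g * n
prime^∣y*geo⇔ {p} {y} {g} pp reg (divides c eq , ∤y) a n =
  ⇔.trans (∣-congʳ-⇔ (trans (cong (_* geo y n) eq) (*-assoc c (p ^ g) _)))
  (⇔.trans (prime^-∣-*-⇔ pp p∤c a)
  (*-^-∣-cong p (λ b → prime^∣geo⇔ pp reg b n) a g))
  where
  instance _ = prime⇒nonZero pp
  p∤c : ¬ p ∣ c
  p∤c p∣c = ∤y (subst (p ^ suc g ∣_) (sym eq) (*-monoˡ-∣ (p ^ g) p∣c))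

∣-1∣≡ : ∀ {x z} → x ≡ 1 + z → ∣ x - 1 ∣ ≡ z
∣-1∣≡ {z = z} refl = ∣-∣-identityʳ z

≡1+∣-1∣ : ∀ {x} → 0 < x → x ≡ 1 + ∣ x - 1 ∣
≡1+∣-1∣ {suc x} _ = cong suc (sym (∣-∣-identityʳ x))

-- The right-hand side mentions `x` only through `g`. This allows two bases to be compared.
prime^∣x^vq-1⇔ : ∀ {p x v y g} → Prime p → x ^ v ≡ 1 + y → Regular p y → IsExponent p y g →
                 ∀ a q → p ^ a ∣ ∣ x ^ (v * q) - 1 ∣ ⇔ p ^ a ∣ p ^ g * q
prime^∣x^vq-1⇔ {p} {x} {v} {y} {g} pp eq reg ex a q =
  ⇔.trans (∣-congʳ-⇔ (∣-1∣≡ (trans (sym (^-*-assoc x v q))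
    (trans (cong (_^ q) eq) ([1+y]^n≡1+y*geo y q)))))
  (prime^∣y*geo⇔ {g = g} pp reg ex a q)

-- Changing the base of a power modulo `D`

^-cong-mod : ∀ k D m n → ∃ λ s → (k + D * m) ^ n ≡ k ^ n + D * s
^-cong-mod k D m zero    = 0 , cong (1 +_) (sym (*-zeroʳ D))
^-cong-mod k D m (suc n) with s , eq ← ^-cong-mod k D m n =
  k * s + m * (k ^ n + D * s) ,
  trans (cong ((k + D * m) *_) eq) (identity k D m (k ^ n) s)
  where
  identity : ∀ k D m x s →
    (k + D * m) * (x + D * s) ≡ k * x + D * (k * s + m * (x + D * s))
  identity = solve-∀

isExponent-cong-mod : ∀ {p y g} s → IsExponent p y g → IsExponent p (y + p ^ suc g * s) g
isExponent-cong-mod {p} {y} {g} s (d , ∤) =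
  ∣m∣n⇒∣m+n d (∣-trans (n∣m*n p) (m∣m*n s)) , ∤ ∘ to (∣-+-⇔ (m∣m*n s))

regular-cong-mod : ∀ {p y g} s → Regular p y → IsExponent p y g → Regular p (y + p ^ suc g * s)
-- Regularity forces p ∣ y, so g = 0 is impossible. For positive exponents the added multiple of
-- `p ^ suc g` is divisible by p², which preserves the condition 4 ∣ y when p = 2.
regular-cong-mod {p} {g = zero} s (t , refl , _) (_ , ∤) =
  contradiction (∣m⇒∣m*n t (∣-reflexive (*-identityʳ p))) ∤
regular-cong-mod {p} {g = suc g} s (t , refl , p∣) _ =
  t + p * p ^ g * s , identity p t (p ^ g) s ,
  subst (p ∣_) (sym (*-distribʳ-+ (tri p) t (p * p ^ g * s)))
    (∣m∣n⇒∣m+n p∣ (∣m⇒∣m*n (tri p) (∣m⇒∣m*n s (m∣m*n (p ^ g)))))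
  where
  identity : ∀ p t x s → p * t + p * (p * x) * s ≡ p * (t + p * x * s)
  identity = solve-∀

-- Changing `k` modulo `p ^ suc g` alters `y` by a multiple of `p ^ suc g`, keeping its exponent `g`
-- and its regularity. Both sides thus reduce to p ^ a ∣ p ^ g * q.
prime^∣-cong-mod : ∀ {p k v y g D} m → Prime p → k ^ v ≡ 1 + y → Regular p y → IsExponent p y g →
                   p ^ suc g ∣ D → ∀ a q →
                   p ^ a ∣ ∣ k ^ (v * q) - 1 ∣ ⇔ p ^ a ∣ ∣ (k + D * m) ^ (v * q) - 1 ∣
prime^∣-cong-mod {p} {k} {v} {y} {g} {D} m pp eq reg ex (divides-refl d) a q
  with s , eq′ ← ^-cong-mod k D m v =
  ⇔.trans (prime^∣x^vq-1⇔ {v = v} {g = g} pp eq reg ex a q)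
  (⇔.sym (prime^∣x^vq-1⇔ {v = v} {y = y + p ^ suc g * (d * s)} {g = g} pp
     (trans eq′ (cong₂ _+_ eq (identity d (p ^ suc g) s)))
     (regular-cong-mod {g = g} (d * s) reg ex) (isExponent-cong-mod {p} {g = g} (d * s) ex) a q))
  where
  identity : ∀ d x s → d * x * s ≡ x * (d * s)
  identity = solve-∀

∣^-1⇔-cong-mod : ∀ {d D k} m → 0 < k → d ∣ D → ∀ n →
                 d ∣ ∣ k ^ n - 1 ∣ ⇔ d ∣ ∣ (k + D * m) ^ n - 1 ∣
∣^-1⇔-cong-mod {d} {D} {k} m 0<k d∣D n with s , eq ← ^-cong-mod k D m n =
  ⇔.sym (⇔.trans (∣-congʳ-⇔ (∣-1∣≡ (trans eq
    (cong (_+ D * s) (≡1+∣-1∣ (m^n>0 k {{>-nonZero 0<k}} n))))))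
  (∣-+-⇔ (∣m⇒∣m*n s d∣D)))

-- Orders, exponents and the cases of `γ`

unitExponent⇒order-∣ : ∀ {N k v n} → 0 < k → IsOrder N k v → N ∣ ∣ k ^ n - 1 ∣ → v ∣ n
unitExponent⇒order-∣ {N} {k} {v} {n} 0<k ((0<v , divides z eq) , least) N∣ =
  -- A positive remainder would be a unit exponent smaller than the order.
  m%n≡0⇒n∣m n v (n≤0⇒n≡0 (≮⇒≥ λ 0<r →
    <⇒≱ (m%n<n n v) (least (n % v) (0<r , remainder))))
  where
  instance
    _ = >-nonZero 0<v
    _ = >-nonZero 0<k
  r = n % v
  q = n / v
  k^v≡ : k ^ v ≡ 1 + N * z
  k^v≡ = trans (≡1+∣-1∣ (m^n>0 k v)) (cong suc (trans eq (*-comm z N)))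
  k^n≡ : ∃ λ s → k ^ n ≡ 1 + (∣ k ^ r - 1 ∣ + N * s)
  -- `^-cong-mod` at base 1: a power of 1 + N z is again 1 plus a multiple of `N`, so `k ^ n` and
  -- `k ^ r` agree modulo `N`.
  k^n≡ with s , eq′ ← ^-cong-mod 1 N z q = k ^ r * s , (begin
    k ^ n                            ≡⟨ cong (k ^_) (m≡m%n+[m/n]*n n v) ⟩
    k ^ (r + q * v)                  ≡⟨ ^-distribˡ-+-* k r (q * v) ⟩
    k ^ r * k ^ (q * v)              ≡⟨ cong (λ e → k ^ r * k ^ e) (*-comm q v) ⟩
    k ^ r * k ^ (v * q)              ≡⟨ cong (k ^ r *_) (^-*-assoc k v q) ⟨
    k ^ r * (k ^ v) ^ q              ≡⟨ cong (λ x → k ^ r * x ^ q) k^v≡ ⟩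
    k ^ r * (1 + N * z) ^ q          ≡⟨ cong (k ^ r *_) eq′ ⟩
    k ^ r * (1 ^ q + N * s)          ≡⟨ cong (λ x → k ^ r * (x + N * s)) (^-zeroˡ q) ⟩
    k ^ r * (1 + N * s)              ≡⟨ identity (k ^ r) N s ⟩
    k ^ r + N * (k ^ r * s)          ≡⟨ cong (_+ N * (k ^ r * s)) (≡1+∣-1∣ (m^n>0 k r)) ⟩
    1 + (∣ k ^ r - 1 ∣ + N * (k ^ r * s)) ∎)
    where
    open ≡-Reasoning
    identity : ∀ x N s → x * (1 + N * s) ≡ x + N * (x * s)
    identity = solve-∀
  remainder : N ∣ ∣ k ^ r - 1 ∣
  remainder with s , eq′ ← k^n≡ = to (∣-+-⇔ (m∣m*n s)) (subst (N ∣_) (∣-1∣≡ eq′) N∣)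

exponent-exists : ∀ {p} → .{{NonTrivial p}} → ∀ x → 0 < x → ∃ (IsExponent p x)
exponent-exists {p} = <-rec (λ x → 0 < x → ∃ (IsExponent p x)) step
  where
  instance _ = nonTrivial⇒nonZero p
  step : ∀ x → (∀ {z} → z < x → 0 < z → ∃ (IsExponent p z)) → 0 < x → ∃ (IsExponent p x)
  step x rec 0<x with p ∣? x
  ... | no p∤x = 0 , 1∣ x , p∤x ∘ subst (_∣ x) (*-identityʳ p)
  ... | yes (divides-refl zero) = contradiction 0<x (<-irrefl refl)
  ... | yes (divides-refl q@(suc _)) with e , d , ∤ ← rec (m<m*n q p (nonTrivial⇒n>1 p)) z<s =
    suc e , subst (p ^ suc e ∣_) (*-comm p q) (*-monoʳ-∣ p d) ,
    λ d′ → ∤ (*-cancelˡ-∣ p (subst (p ^ suc (suc e) ∣_) (*-comm q p) d′))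

ν-isExponent : ∀ {p x} → Prime p → 0 < x → IsExponent p x (ν p x)
ν-isExponent {p} {x} pp 0<x with exponent? p x
... | yes (_ , ex) = ex
... | no none      = contradiction (exponent-exists {{prime⇒nonTrivial pp}} x 0<x) none

-- Exposes the branches of `γ`, so that later proofs need not repeat its `with`.
γ-cases : ∀ p k →
  (p ≡ 2 × TwiceOdd (k ∸ 1) × γ p k ≡ ν 2 ∣ k ^ 2 - 1 ∣) ⊎
  (¬ (p ≡ 2 × TwiceOdd (k ∸ 1)) × ∃ λ u → IsOrder p k u × γ p k ≡ ν p ∣ k ^ u - 1 ∣) ⊎
  ¬ ∃ (IsOrder p k)
γ-cases p k with p ≟ 2 ×-dec twiceOdd? (k ∸ 1) | order? p k
... | yes (p≡2 , odd) | _               = inj₁ (p≡2 , odd , refl)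
... | no ¬special     | yes (u , order) = inj₂ (inj₁ (¬special , u , order , refl))
... | no _            | no none         = inj₂ (inj₂ none)

0<∣k^v-1∣ : ∀ {k v} → 1 < k → 0 < v → 0 < ∣ k ^ v - 1 ∣
0<∣k^v-1∣ {k} {v} 1<k 0<v = n≢0⇒n>0 λ eq →
  case m^n≡1⇒n≡0∨m≡1 k v (∣m-n∣≡0⇒m≡n eq) of λ where
    (inj₁ refl) → <-irrefl refl 0<v
    (inj₂ refl) → <-irrefl refl 1<k

-- Only p = 2 needs an argument: `k` is odd and not 3 modulo 4, so k = 1 + 4 i, and its order modulo
-- 2 is 1.
order-regular : ∀ {p k u} → Prime p → 0 < k → ¬ (p ≡ 2 × TwiceOdd (k ∸ 1)) → IsOrder p k u →
                Regular p ∣ k ^ u - 1 ∣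
order-regular {p} {k} {u} pp 0<k ¬special ((0<u , p∣) , least) with p ≟ 2
... | no p≢2 = regular-odd pp p≢2 p∣
... | yes refl with parity-split k
...   | j , inj₁ refl =
  contradiction (unitExponent⇒coprime {k = k} {u} (0<u , p∣) (∣-refl , m∣m*n j)) λ ()
...   | j , inj₂ refl with parity-split j
...     | i , inj₂ refl = contradiction (refl , i , cong (2 *_) (+-comm 1 (2 * i))) ¬special
...     | i , inj₁ refl = subst (Regular 2) (sym eq) (regular-2 i)
  where
  identity : ∀ i → (1 + 2 * (2 * i)) * 1 ≡ 1 + 4 * i
  identity = solve-∀
  u≡1 : u ≡ 1
  u≡1 = ≤-antisym (least 1 (z<s , subst (2 ∣_)
    (sym (∣-1∣≡ {z = 2 * (2 * i)} (*-identityʳ k))) (m∣m*n (2 * i)))) 0<u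
  eq : ∣ k ^ u - 1 ∣ ≡ 4 * i
  eq = ∣-1∣≡ (trans (cong (k ^_) u≡1) (identity i))

module _ {k : ℕ} (odd : TwiceOdd (k ∸ 1)) (1<k : 1 < k) where

  private
    j = proj₁ odd

    k≡3+4j : k ≡ 3 + 4 * j
    k≡3+4j = trans (sym (m+[n∸m]≡n (<⇒≤ 1<k))) (trans (cong (1 +_) (proj₂ odd)) (identity j))
      where
      identity : ∀ j → 1 + 2 * (2 * j + 1) ≡ 3 + 4 * j
      identity = solve-∀

    k²≡ : k ^ 2 ≡ 1 + 4 * (2 + 6 * j + 4 * (j * j))
    k²≡ = trans (cong (_^ 2) k≡3+4j) (identity j)
      where
      identity : ∀ j → (3 + 4 * j) * ((3 + 4 * j) * 1) ≡ 1 + 4 * (2 + 6 * j + 4 * (j * j))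
      identity = solve-∀

  twiceOdd-regular : Regular 2 ∣ k ^ 2 - 1 ∣
  twiceOdd-regular = subst (Regular 2) (sym (∣-1∣≡ k²≡)) (regular-2 (2 + 6 * j + 4 * (j * j)))

  -- As k² ≡ 1 modulo 4, an odd power of `k` is ≡ k ≡ 3, leaving the remainder 2 after subtracting
  -- 1.
  4∣k^n-1⇒2∣n : ∀ n → 4 ∣ ∣ k ^ n - 1 ∣ → 2 ∣ n
  4∣k^n-1⇒2∣n n 4∣ with parity-split n
  ... | i , inj₁ refl = m∣m*n i
  ... | i , inj₂ refl with s , eq ← ^-cong-mod 1 4 (2 + 6 * j + 4 * (j * j)) i =
    contradiction (to (∣-+-⇔ {4} {2} (m∣m*n (j + k * s))) (subst (4 ∣_) (∣-1∣≡ k^n≡) 4∣))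
      λ 4∣2 → <⇒≱ {2} {4} (s≤s (s≤s (s≤s z≤n))) (∣⇒≤ 4∣2)
    where
    open ≡-Reasoning
    identity : ∀ j x → 3 + 4 * j + 4 * x ≡ 1 + (2 + 4 * (j + x))
    identity = solve-∀
    identity′ : ∀ k s → k * (1 + 4 * s) ≡ k + 4 * (k * s)
    identity′ = solve-∀
    k^n≡ : k ^ (1 + 2 * i) ≡ 1 + (2 + 4 * (j + k * s))
    k^n≡ = begin
      k * k ^ (2 * i)        ≡⟨ cong (k *_) (^-*-assoc k 2 i) ⟨
      k * (k ^ 2) ^ i        ≡⟨ cong (λ x → k * x ^ i) k²≡ ⟩
      k * (1 + 4 * (2 + 6 * j + 4 * (j * j))) ^ i ≡⟨ cong (k *_) eq ⟩
      k * (1 ^ i + 4 * s)    ≡⟨ cong (λ x → k * (x + 4 * s)) (^-zeroˡ i) ⟩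
      k * (1 + 4 * s)        ≡⟨ identity′ k s ⟩
      k + 4 * (k * s)        ≡⟨ cong (_+ 4 * (k * s)) k≡3+4j ⟩
      3 + 4 * j + 4 * (k * s) ≡⟨ identity j (k * s) ⟩
      1 + (2 + 4 * (j + k * s)) ∎

-- The equivalence at a single prime

-- For a ≤ g the congruence k ≡ k + D m (mod p^g) already decides the matter.
prime^-cong-above : ∀ {p k D} m → 0 < k → ∀ g → p ^ g ∣ D → ∀ a n →
  (p ^ g ∣ ∣ k ^ n - 1 ∣ → p ^ a ∣ ∣ k ^ n - 1 ∣ ⇔ p ^ a ∣ ∣ (k + D * m) ^ n - 1 ∣) →
  p ^ a ∣ ∣ k ^ n - 1 ∣ ⇔ p ^ a ∣ ∣ (k + D * m) ^ n - 1 ∣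
prime^-cong-above {p} m 0<k g p^g∣D a n large with ≤-total a g
... | inj₁ a≤g = ∣^-1⇔-cong-mod m 0<k (∣-trans (^-monoʳ-∣ p a≤g) p^g∣D) n
... | inj₂ g≤a = mk⇔
  (λ d → large (∣-trans (^-monoʳ-∣ p g≤a) d) .to d)
  (λ d → large (from (∣^-1⇔-cong-mod m 0<k p^g∣D n) (∣-trans (^-monoʳ-∣ p g≤a) d)) .from d)

-- The common core of both nontrivial cases of `γ`. Above the threshold `suc g`, either side yields
-- p ^ suc g ∣ k ^ n - 1, the separation hypothesis turns this into v ∣ n, and lifting the exponent
-- applies.
prime^-ν-cong : ∀ {p k v D} m → Prime p → 1 < k → 0 < v → Regular p ∣ k ^ v - 1 ∣ →
  let g = ν p ∣ k ^ v - 1 ∣ in p ^ suc g ∣ D →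
  (∀ n → p ^ suc g ∣ ∣ k ^ n - 1 ∣ → v ∣ n) →
  ∀ a n → p ^ a ∣ ∣ k ^ n - 1 ∣ ⇔ p ^ a ∣ ∣ (k + D * m) ^ n - 1 ∣
prime^-ν-cong {p} {k} {v} {D} m pp 1<k 0<v reg p^g∣D sep a n =
  prime^-cong-above m 0<k (suc g) p^g∣D a n λ d → multiple (sep n d)
  where
  0<k = <⇒≤ 1<k
  g = ν p ∣ k ^ v - 1 ∣
  multiple : v ∣ n → p ^ a ∣ ∣ k ^ n - 1 ∣ ⇔ p ^ a ∣ ∣ (k + D * m) ^ n - 1 ∣
  multiple (divides-refl q) rewrite *-comm q v =
    prime^∣-cong-mod {v = v} {g = g} m pp (≡1+∣-1∣ (m^n>0 k {{>-nonZero 0<k}} v)) reg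
      (ν-isExponent pp (0<∣k^v-1∣ {v = v} 1<k 0<v)) p^g∣D a q

prime^-γ-cong : ∀ {p k D} m → Prime p → 1 < k → p ^ suc (γ p k) ∣ D → ∀ a n → 0 < n →
                p ^ a ∣ ∣ k ^ n - 1 ∣ ⇔ p ^ a ∣ ∣ (k + D * m) ^ n - 1 ∣
prime^-γ-cong {p} {k} {D} m pp 1<k p^γ∣D a n 0<n with γ-cases p k
... | inj₁ (refl , odd , eq) rewrite eq =
  prime^-ν-cong {v = 2} m pp 1<k z<s reg p^γ∣D
    -- Here v = 2 is not the order modulo 2, which is 1. It is detected modulo 4, and 4 divides
    -- `2 ^ suc g` because g is positive.
    (λ n d → 4∣k^n-1⇒2∣n odd 1<k n (∣-trans (^-monoʳ-∣ 2 (s≤s 0<g)) d)) a n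
  where
  reg = twiceOdd-regular odd 1<k
  0<g : 0 < ν 2 ∣ k ^ 2 - 1 ∣
  0<g = n≢0⇒n>0 λ g≡0 → proj₂ (ν-isExponent pp (0<∣k^v-1∣ {v = 2} 1<k z<s))
    (subst (λ g → 2 ^ suc g ∣ ∣ k ^ 2 - 1 ∣) (sym g≡0)
      (subst (2 ∣_) (sym (proj₁ (proj₂ reg))) (m∣m*n (proj₁ reg))))
... | inj₂ (inj₁ (¬special , u , order , eq)) rewrite eq =
  prime^-ν-cong {v = u} m pp 1<k (proj₁ (proj₁ order))
    (order-regular pp (<⇒≤ 1<k) ¬special order) p^γ∣D
    (λ n d → unitExponent⇒order-∣ (<⇒≤ 1<k) order (∣-trans (m∣m*n _) d)) a n
-- Without an order modulo `p`, no positive `n` has p ∣ k ^ n - 1, so the range above the threshold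
-- is vacuous. Positivity of `n` matters: k ^ 0 - 1 is 0.
... | inj₂ (inj₂ none) =
  prime^-cong-above m (<⇒≤ 1<k) (suc (γ p k)) p^γ∣D a n λ d → contradiction
    (_ , coprime⇒isOrder {{prime⇒nonZero pp}}
      (unitExponent⇒coprime {k = k} {n} (0<n , ∣-trans (m∣m*n _) d))) none

-- Products of powers of distinct primes

∣∏ : ∀ {r} (f : Fin r → ℕ) i → f i ∣ ∏ f
∣∏ f zero    = m∣m*n (∏ (f ∘ suc))
∣∏ f (suc i) = ∣n⇒∣m*n (f zero) (∣∏ (f ∘ suc) i)

prime∣∏⇒∣ : ∀ {r p} → Prime p → (f : Fin r → ℕ) → p ∣ ∏ f → ∃ λ i → p ∣ f i
prime∣∏⇒∣ {zero}  pp f p∣1 = contradiction p∣1 (1∤prime pp)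
prime∣∏⇒∣ {suc r} pp f p∣ with euclidsLemma (f zero) (∏ (f ∘ suc)) pp p∣
... | inj₁ p∣f₀ = zero , p∣f₀
... | inj₂ p∣∏ with i , p∣fᵢ ← prime∣∏⇒∣ pp (f ∘ suc) p∣∏ = suc i , p∣fᵢ

-- Write x = c P with P the product over the remaining primes. The first prime does not divide P, so
-- its power divides c.
∏prime^∣ : ∀ {r} (p : Fin r → ℕ) → (∀ i → Prime (p i)) → Injective _≡_ _≡_ p →
           ∀ (a : Fin r → ℕ) {x} → (∀ i → p i ^ a i ∣ x) → ∏ (λ i → p i ^ a i) ∣ x
∏prime^∣ {zero}  p pp inj a {x} _ = 1∣ x
∏prime^∣ {suc r} p pp inj a {x} h
  with ∏prime^∣ (p ∘ suc) (pp ∘ suc) (suc-injective ∘ inj) (a ∘ suc) {x} (h ∘ suc)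
... | divides-refl c = *-monoˡ-∣ P (prime^-cancel (pp zero) p₀∤P (a zero)
  (subst (p zero ^ a zero ∣_) (*-comm c P) (h zero)))
  where
  P = ∏ (λ i → p (suc i) ^ a (suc i))
  p₀∤P : ¬ p zero ∣ P
  p₀∤P d with i , d′ ← prime∣∏⇒∣ (pp zero) (λ i → p (suc i) ^ a (suc i)) d
    with () ← inj (prime∣prime⇒≡ (pp zero) (pp (suc i)) (prime∣^⇒∣ (pp zero) (p (suc i)) (a (suc i)) d′))

∏prime^∣⇔ : ∀ {r} (p : Fin r → ℕ) → (∀ i → Prime (p i)) → Injective _≡_ _≡_ p →
            ∀ (a : Fin r → ℕ) {x} → ∏ (λ i → p i ^ a i) ∣ x ⇔ (∀ i → p i ^ a i ∣ x)
∏prime^∣⇔ p pp inj a = mk⇔ (λ d i → ∣-trans (∣∏ (λ i → p i ^ a i) i) d) (∏prime^∣ p pp inj a)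

-- Comparison of orders

isOrder-cong : ∀ {N k l u} → (∀ n → UnitExponent N k n ⇔ UnitExponent N l n) →
               IsOrder N k u → IsOrder N l u
isOrder-cong k⇔l (e , least) = k⇔l _ .to e , λ m → least m ∘ k⇔l m .from

-- Equal sets of unit exponents have the same least element, or are both empty and give the default
-- 0.
O-cong : ∀ {N k l} → (∀ n → UnitExponent N k n ⇔ UnitExponent N l n) → O N k ≡ O N l
O-cong {N} {k} {l} k⇔l with order? N k | order? N l
... | yes (u , e , least) | yes (v , e′ , least′) =
  ≤-antisym (least v (k⇔l v .from e′)) (least′ u (k⇔l u .to e))
... | yes (u , order) | no none = contradiction (u , isOrder-cong k⇔l order) none
... | no none | yes (u , order) = contradiction (u , isOrder-cong (⇔.sym ∘ k⇔l) order) none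
... | no _ | no _ = refl

prime^γ∣Λ : ∀ {r} (p : Fin r → ℕ) {k} → 1 < k → ∀ i → p i ^ suc (γ (p i) k) ∣ Λ p k
prime^γ∣Λ p {k} 1<k i with k ≟ 1
... | yes refl = contradiction 1<k (<-irrefl refl)
... | no _     = subst (λ e → p i ^ e ∣ ∏ f) (+-comm (γ (p i) k) 1) (∣∏ f i)
  where f = λ i → p i ^ (γ (p i) k + 1)

theorem4 : ∀ {r} (p : Fin r → ℕ) → (∀ i → Prime (p i)) → Injective _≡_ _≡_ p →
    ∀ (k m : ℕ) → 0 < k → 0 < m →
    ∀ (N : ℕ) → N ∈ η p → gcd N k ≡ 1 →
    O N (k + Λ p k * m) ≡ O N k
-- For k = 1, `Λ p 1` computes to 0 and the base stays 1.
theorem4 p pp inj 1 m _ _ N _ _ = refl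
theorem4 p pp inj k@(2+ _) m _ _ N (a , refl) _ = sym (O-cong λ n →
  mk⇔ (λ (0<n , d) → 0<n , cong-mod n 0<n .to d) (λ (0<n , d) → 0<n , cong-mod n 0<n .from d))
  where
  1<k : 1 < k
  1<k = s≤s z<s
  cong-mod : ∀ n → 0 < n → N ∣ ∣ k ^ n - 1 ∣ ⇔ N ∣ ∣ (k + Λ p k * m) ^ n - 1 ∣
  cong-mod n 0<n = mk⇔
    (λ d → split .from λ i → local i .to (split .to d i))
    (λ d → split .from λ i → local i .from (split .to d i))
    where
    split : ∀ {x} → N ∣ x ⇔ (∀ i → p i ^ a i ∣ x)
    split = ∏prime^∣⇔ p pp inj a
    local = λ i → prime^-γ-cong m (pp i) 1<k (prime^γ∣Λ p 1<k i) (a i) n 0<n
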